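{- Let $T$ be a tree on $n$ nodes labeled from an alphabet of size $\sigma$. Then the top DAG obtained by the modified top tree construction algorithm described in the context, with parameter $\alpha=10/9$, has size $O\!\left(\frac{n}{\log_\sigma n}\right)$.
   Context: Trees are rooted and ordered, with node labels from an alphabet $\Sigma$. For a node $v$ with children $v_1,\dots,v_k$, $T(v)$ is the subtree rooted at $v$, $F(v)=T(v_1)\cup\dots\cup T(v_k)$, and $T(v,v_s,v_r)=\{v\}\cup T(v_s)\cup\dots\cup T(v_r)$. A cluster is either $T(v,v_s,v_r)$ (top boundary node $v$) or $T(v,v_s,v_r)\setminus F(u)$ for $u\in T(v,v_s,v_r)\setminus\{v\}$ (top boundary $v$, bottom boundary $u$). Two edge-disjoint clusters sharing exactly one boundary node whose union is a cluster can be merged into the union; there are five possible types of such merges. The size of a cluster is the number of edges of $T$ it contains. A top tree of $T$ is an ordered labeled binary tree whose nodes are clusters: the root is $T$; the leaves are the edges of $T$, a leaf for edge $(u,v)$ ($u$ the parent) labeled by (label of $u$, label of $v$); each internal node is the merge of its two children, labeled by the merge type (one of 5 labels), the left child being the cluster visited first in preorder of $T$. The original algorithm (Bille et al.) maintains an ordered tree $\widetilde T$, initially $T$, whose edges correspond to the current clusters; merging two edges of $\widetilde T$ merges the corresponding clusters and replaces them by one edge (a vertical merge of $(v_1,v_2),(v_2,v_3)$ removes $v_2$ and creates edge $(v_1,v_3)$; a horizontal merge of two sibling edges below $v$, one of which goes to a leaf, removes that leaf). One iteration of the original algorithm consists of: (1) Horizontal merges: for each node $v$ of $\widetilde T$ with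 $k\ge2$ children $v_1,\dots,v_k$, for $i=1,\dots,\lfloor k/2\rfloor$ merge $(v,v_{2i-1})$ and $(v,v_{2i})$ if $v_{2i-1}$ or $v_{2i}$ is a leaf; if $k$ is odd, $v_k$ is a leaf and $v_{k-2},v_{k-1}$ are non-leaves, also merge $(v,v_{k-1})$ and $(v,v_k)$. (2) Vertical merges: for each maximal path $v_1,\dots,v_p$ with $v_{i+1}$ the parent of $v_i$ and $v_2,\dots,v_{p-1}$ having a single child: if $p$ is even merge consecutive pairs $\{(v_1,v_2),(v_2,v_3)\},\{(v_3,v_4),(v_4,v_5)\},\dots$ up to the edge $(v_{p-2},v_{p-1})$; if $p$ is odd merge consecutive pairs up to the edge $(v_{p-3},v_{p-2})$, and if $(v_{p-1},v_p)$ was not merged in step (1) also merge $\{(v_{p-2},v_{p-1}),(v_{p-1},v_p)\}$. The modified algorithm with parameter $\alpha>1$: for $t=1,2,\dots$ (until a single cluster remains), in the $t^\text{th}$ iteration it computes all merges that one iteration of the original algorithm (both steps) would perform on the current $\widetilde T$, and applies only those merges in which both participating clusters have size at most $\alpha^t$. The recorded merges form a top tree $\mathcal T$ of $T$; the top DAG is the minimal DAG representation of $\mathcal T$ obtained by identifying identical (isomorphic as ordered labeled trees) subtrees, and its size is its number of nodes. -}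

module Defs where

open import Data.Nat using (ℕ; zero; suc; _+_; _*_; _^_; _≤_; _≤?_)
open import Data.Fin using (Fin; zero; suc) renaming (_≟_ to _≟F_)
open import Data.List using (List; []; _∷_; _++_; length; deduplicate)
open import Data.Bool using (Bool; true; false; _∨_; _∧_; not; if_then_else_)
open import Data.Product using (_×_; _,_)
open import Relation.Nullary using (yes; no; does)
open import Relation.Binary.PropositionalEquality using (_≡_; refl)
open import Relation.Binary.Definitions using (DecidableEquality)

data Tree (A : Set) : Set where
  node : A → List (Tree A) → Tree A

label : ∀ {A : Set} → Tree A → A
label (node a _) = a

mutual
  nodeCount : ∀ {A : Set} → Tree A → ℕ
  nodeCount (node _ ts) = suc (nodeCountList ts)

  nodeCountList : ∀ {A : Set} → List (Tree A) → ℕ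
  nodeCountList [] = 0
  nodeCountList (t ∷ ts) = nodeCount t + nodeCountList ts

-- Top trees: binary trees, leaves = edges labelled (label parent, label child),
-- internal nodes labelled by one of the 5 merge types.

MergeType : Set
MergeType = Fin 5

-- (a) vertical, the union has a bottom boundary node
vertA : MergeType
vertA = zero
-- (b) vertical, the union has no bottom boundary node
vertB : MergeType
vertB = suc zero
-- (c) horizontal, neither cluster has a bottom boundary node
horC : MergeType
horC = suc (suc zero)
-- (d) horizontal, the left cluster has a bottom boundary node
horD : MergeType
horD = suc (suc (suc zero))
-- (e) horizontal, the right cluster has a bottom boundary node
horE : MergeType
horE = suc (suc (suc (suc zero)))

data TopTree (σ : ℕ) : Set where
  leaf  : Fin σ → Fin σ → TopTree σ
  merge : MergeType → TopTree σ → TopTree σ → TopTree σ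

-- size of the cluster = number of edges of T = number of leaves of its top tree
edges : ∀ {σ} → TopTree σ → ℕ
edges (leaf _ _) = 1
edges (merge _ l r) = edges l + edges r

_≟T_ : ∀ {σ} → DecidableEquality (TopTree σ)
leaf a b ≟T leaf c d with a ≟F c | b ≟F d
... | yes refl | yes refl = yes refl
... | no ne | _ = no λ { refl → ne refl }
... | yes _ | no ne = no λ { refl → ne refl }
leaf _ _ ≟T merge _ _ _ = no λ ()
merge _ _ _ ≟T leaf _ _ = no λ ()
merge m l r ≟T merge m' l' r' with m ≟F m' | l ≟T l' | r ≟T r'
... | yes refl | yes refl | yes refl = yes refl
... | no ne | _ | _ = no λ { refl → ne refl }
... | yes _ | no ne | _ = no λ { refl → ne refl }
... | yes _ | yes _ | no ne = no λ { refl → ne refl }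

subtrees : ∀ {σ} → TopTree σ → List (TopTree σ)
subtrees t@(leaf _ _) = t ∷ []
subtrees t@(merge _ l r) = t ∷ (subtrees l ++ subtrees r)

dagSize : ∀ {σ} → TopTree σ → ℕ
dagSize t = length (deduplicate _≟T_ (subtrees t))

-- The tree T~ : ordered tree whose edges carry the (top trees of the)
-- current clusters.

data CTree (σ : ℕ) : Set where
  cnode : List (TopTree σ × CTree σ) → CTree σ

mutual
  initT : ∀ {σ} → Tree (Fin σ) → CTree σ
  initT (node a ts) = cnode (initL a ts)

  initL : ∀ {σ} → Fin σ → List (Tree (Fin σ)) → List (TopTree σ × CTree σ)
  initL a [] = []
  initL a (t ∷ ts) = (leaf a (label t) , initT t) ∷ initL a ts

isLeaf : ∀ {σ} → CTree σ → Bool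
isLeaf (cnode []) = true
isLeaf (cnode (_ ∷ _)) = false

singleCluster : ∀ {σ} → TopTree σ → CTree σ
singleCluster tt = cnode ((tt , cnode []) ∷ [])

-- One iteration (number t) of the modified algorithm with α = p / q:
-- the merges of one iteration of the original algorithm are computed on
-- the current T~, and only those whose two clusters both have size ≤ α^t
-- (i.e. size * q^t ≤ p^t) are applied.

module Step {σ : ℕ} (p q t : ℕ) where

  TT : Set
  TT = TopTree σ

  CT : Set
  CT = CTree σ

  small : TT → Bool
  small x = does (edges x * q ^ t ≤? p ^ t)

  ok : TT → TT → Bool
  ok x y = small x ∧ small y

  -- vertical merge: upper cluster (first in preorder) is the left child;
  -- y is the bottom node of the lower edge.
  vmerge : TT → TT → CT → TT
  vmerge up lo y = merge (if isLeaf y then vertB else vertA) up lo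

  -- Result of processing a non-root node x of T~ (bottom-up along the
  -- maximal vertical paths, pairs being formed from the bottom):
  --   even c  : processed subtree at x; no pending edge below x
  --   odd e y : x has a single child edge e to (processed) y, and this edge
  --             is still unpaired (it is an odd-indexed edge e_{2j-1} of its path)
  data Res : Set where
    even : CT → Res
    odd  : TT → CT → Res

  -- a child edge of a "top" node (the root or a node with ≠ 1 children):
  -- its cluster, whether its child is a leaf in T~, and the processed child
  Item : Set
  Item = TT × Bool × Res

  leafOf : Item → Bool
  leafOf (_ , b , _) = b

  clusterOf : Item → TT
  clusterOf (x , _ , _) = x

  data Seg : Set where
    one : Item → Seg
    two : Item → Item → Seg

  pd : Item → Item → List Seg
  pd x y = if leafOf x ∨ leafOf y then two x y ∷ [] else one x ∷ one y ∷ []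

  plan : List Item → List Seg
  plan [] = []
  plan (x ∷ []) = one x ∷ []
  plan (x ∷ y ∷ []) = pd x y
  plan (x ∷ y ∷ z ∷ []) =
    if not (leafOf x) ∧ not (leafOf y) ∧ leafOf z
    then one x ∷ two y z ∷ []
    else pd x y ++ (one z ∷ [])
  plan (x ∷ y ∷ z ∷ w ∷ rest) = pd x y ++ plan (z ∷ w ∷ rest)

  -- the top edge (v_{p-1}, v_p) of a maximal path; hor = it was merged in step (1)
  resolve : Bool → Item → TT × CT
  resolve hor (tt , _ , even c') = tt , c'
  resolve hor (tt , _ , odd tt' y') =
    if not hor ∧ ok tt tt'
    then (vmerge tt tt' y' , y')
    else (tt , cnode ((tt' , y') ∷ []))

  htype : Item → Item → MergeType
  htype x y =
    if leafOf x ∧ leafOf y then horC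
    else (if leafOf y then horD else horE)

  hm : Item → Item → List (TT × CT)
  hm x y with resolve true x | resolve true y
  ... | (t1 , c1) | (t2 , c2) =
    if ok t1 t2
    then (merge (htype x y) t1 t2 , (if leafOf x then c2 else c1)) ∷ []
    else (t1 , c1) ∷ (t2 , c2) ∷ []

  realize : List Seg → List (TT × CT)
  realize [] = []
  realize (one x ∷ ss) = resolve false x ∷ realize ss
  realize (two x y ∷ ss) = hm x y ++ realize ss

  goSingle : TT → Res → Res
  goSingle tt (even c') = odd tt c'
  goSingle tt (odd tt' y') =
    if ok tt tt'
    then even (cnode ((vmerge tt tt' y' , y') ∷ []))
    else even (cnode ((tt , cnode ((tt' , y') ∷ [])) ∷ []))

  mutual
    go : CT → Res
    go (cnode ((tt , c) ∷ [])) = goSingle tt (go c)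
    go (cnode []) = even (cnode [])
    go (cnode (e ∷ e' ∷ es)) = even (cnode (realize (plan (goList (e ∷ e' ∷ es)))))

    goList : List (TT × CT) → List Item
    goList [] = []
    goList ((tt , c) ∷ es) = (tt , isLeaf c , go c) ∷ goList es

  -- the root is always the top end of its maximal paths
  step : CT → CT
  step (cnode cs) = cnode (realize (plan (goList cs)))

runFrom : ∀ {σ} → (p q t k : ℕ) → CTree σ → CTree σ
runFrom p q t zero T = T
runFrom p q t (suc k) T = runFrom p q (suc t) k (Step.step p q t T)

run : ∀ {σ} → (p q k : ℕ) → CTree σ → CTree σ
run p q k T = runFrom p q 1 k T

{-# OPTIONS --safe #-}
module Submission where

-- Let T_t be the tree of clusters after t iterations on a tree with n nodes. An iteration of the
-- unrestricted algorithm removes about 1/8 of the clusters, and a cluster of size above α^t, of which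
-- there are at most n/α^t, blocks at most one merge. As 7/8 · α < 1, T_t has O(n/α^t) clusters.
-- Clusters of size above s arise only once α^t ≥ s/2, and every later merge removes a cluster, so the
-- top tree has O(n/s) nodes of size above s. The other nodes contribute at most (σ² + 5)^(2s) distinct
-- subtrees to the DAG, and s is taken proportional to log n / log σ.

open import Defs
open import Data.Nat using (ℕ; zero; suc; _+_; _*_; _^_; _∸_; _≤_; _<_; _<?_; _≤ᵇ_; _≤?_; z≤n; s≤s; ⌊_/2⌋; ⌈_/2⌉; NonZero)
open import Data.Nat.Properties
open import Data.Nat.DivMod using (_/_; _%_; m/n*n≤m; m≡m%n+[m/n]*n; m%n<n)
open import Data.Nat.Induction using (<-wellFounded)
open import Data.Nat.Logarithm using (⌊log₂_⌋; ⌈log₂_⌉; ⌈log₂⌉-mono-≤)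
open import Data.Nat.Logarithm.Core using (⌊log2⌋; ⌈log2⌉)
open import Data.Nat.Tactic.RingSolver using (solve-∀)
open import Data.Bool using (Bool; T; true; false; _∨_; _∧_; not; if_then_else_)
open import Data.Bool.Properties using (∨-zeroʳ)
open import Data.Fin using (Fin)
open import Data.List using (List; []; _∷_; _++_; length; filter; map; allFin; cartesianProduct; cartesianProductWith; deduplicate)
open import Data.List.Properties using (length-++; length-map; length-tabulate; length-deduplicate; filter-++; filter-accept; filter-reject)
open import Data.List.Membership.Propositional using (_∈_)
open import Data.List.Membership.Propositional.Properties
open import Data.List.Relation.Binary.Subset.Propositional using (_⊆_)
open import Data.List.Relation.Unary.All as All using ()
open import Data.List.Relation.Unary.AllPairs using ([]; _∷_)
open import Data.List.Relation.Unary.Any using (here; there)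
open import Data.List.Relation.Unary.Unique.Propositional using (Unique)
import Data.List.Relation.Unary.Unique.DecPropositional.Properties as Unique
open import Data.Product using (Σ; _×_; _,_; proj₁; proj₂)
open import Data.Sum using (inj₁; inj₂)
open import Data.Vec as Vec using (Vec; []; _∷_)
open import Induction.WellFounded using (Acc; acc)
open import Relation.Binary.PropositionalEquality
open import Relation.Nullary using (Dec; contradiction; yes; no)
open ≤-Reasoning

-- The computed merges form a matching on the clusters: an edge planned for a horizontal merge is
-- withheld from the vertical ones even if the size bound refuses that merge. Hence a large cluster
-- blocks at most one merge, and the loss can be charged to it locally, in one bottom-up pass. The
-- other facts about runs rest mostly on one principle: the total of a function that is subadditive
-- over the applied merges never grows. It is used for the size, for the number of subtrees above
-- `s`, and for one plus that number. Powers of α appear as `10 ^ t` and `9 ^ t` on opposite sides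
-- of an inequality, so no fractions occur. The small trees are affordable if they number at most
-- about the square root of n, which fixes `s`; if `s` would fall below 2, two DAG nodes per edge
-- are already few enough.

-- Linear arithmetic: r is the slack, and the equation is left to the ring solver.
≤-by : ∀ {A B X Y} r → X ≤ Y → A + Y + r ≡ B + X → A ≤ B
≤-by {A} {B} {X} {Y} r X≤Y eq = +-cancelʳ-≤ Y A B (begin
  A + Y      ≤⟨ m≤m+n (A + Y) r ⟩
  A + Y + r  ≡⟨ eq ⟩
  B + X      ≤⟨ +-monoʳ-≤ B X≤Y ⟩
  B + Y      ∎)

-- Additive weights on trees of clusters

module _ {σ : ℕ} where

  mutual
    weight : (TopTree σ → ℕ) → CTree σ → ℕ
    weight f (cnode es) = weights f es

    weights : (TopTree σ → ℕ) → List (TopTree σ × CTree σ) → ℕ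
    weights f [] = 0
    weights f ((x , c) ∷ es) = f x + weight f c + weights f es

  weights-++ : ∀ f es fs → weights f (es ++ fs) ≡ weights f es + weights f fs
  weights-++ f [] fs = refl
  weights-++ f ((x , c) ∷ es) fs rewrite weights-++ f es fs =
    sym (+-assoc (f x + weight f c) (weights f es) (weights f fs))

  mutual
    weight-linear : ∀ a b f g c →
      weight (λ x → a * f x + b * g x) c ≡ a * weight f c + b * weight g c
    weight-linear a b f g (cnode es) = weights-linear a b f g es

    weights-linear : ∀ a b f g es →
      weights (λ x → a * f x + b * g x) es ≡ a * weights f es + b * weights g es
    weights-linear a b f g [] rewrite *-zeroʳ a | *-zeroʳ b = refl
    weights-linear a b f g ((x , c) ∷ es)
      rewrite weight-linear a b f g c | weights-linear a b f g es =
        regroup a b (f x) (weight f c) (weights f es) (g x) (weight g c) (weights g es)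
      where
      regroup : ∀ a b u v w x y z →
        a * u + b * x + (a * v + b * y) + (a * w + b * z) ≡ a * (u + v + w) + b * (x + y + z)
      regroup = solve-∀

  mutual
    weight-mono : ∀ {f g} a b → (∀ x → f x * a ≤ g x * b) → ∀ c → weight f c * a ≤ weight g c * b
    weight-mono a b f≤g (cnode es) = weights-mono a b f≤g es

    weights-mono : ∀ {f g} a b → (∀ x → f x * a ≤ g x * b) → ∀ es → weights f es * a ≤ weights g es * b
    weights-mono a b f≤g [] = z≤n
    weights-mono {f} {g} a b f≤g ((x , c) ∷ es) = begin
      (f x + weight f c + weights f es) * a
        ≡⟨ distrib (f x) (weight f c) (weights f es) a ⟩
      f x * a + weight f c * a + weights f es * a
        ≤⟨ +-mono-≤ (+-mono-≤ (f≤g x) (weight-mono a b f≤g c)) (weights-mono a b f≤g es) ⟩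
      g x * b + weight g c * b + weights g es * b
        ≡⟨ distrib (g x) (weight g c) (weights g es) b ⟨
      (g x + weight g c + weights g es) * b ∎
      where
      distrib : ∀ u v w k → (u + v + w) * k ≡ u * k + v * k + w * k
      distrib = solve-∀

  clusters : CTree σ → ℕ
  clusters = weight (λ _ → 1)

  clustersL : List (TopTree σ × CTree σ) → ℕ
  clustersL = weights (λ _ → 1)

-- Subadditive weights under one iteration

module _ {σ p q t : ℕ} where
  open Step {σ} p q t

  -- Subadditivity is asked only of merges within the size bound: `bigs s` has it in the early
  -- iterations, where that bound keeps every union at size at most `s`.
  module Subadditive (f : TT → ℕ)
    (f-merge : ∀ m x y → ok x y ≡ true → f (merge m x y) ≤ f x + f y) where

    resWeight : Res → ℕ
    resWeight (even c) = weight f c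
    resWeight (odd x c) = f x + weight f c

    itemWeight : Item → ℕ
    itemWeight (x , _ , r) = f x + resWeight r

    itemWeights : List Item → ℕ
    itemWeights [] = 0
    itemWeights (i ∷ is) = itemWeight i + itemWeights is

    segWeights : List Seg → ℕ
    segWeights [] = 0
    segWeights (one i ∷ ss) = itemWeight i + segWeights ss
    segWeights (two i j ∷ ss) = itemWeight i + itemWeight j + segWeights ss

    edgeWeight : TT × CT → ℕ
    edgeWeight (x , c) = f x + weight f c

    resolve-≤ : ∀ b i → edgeWeight (resolve b i) ≤ itemWeight i
    resolve-≤ b (x , _ , even c) = ≤-refl
    resolve-≤ b (x , _ , odd y c) with not b | ok x y in ok-xy
    ... | false | _ rewrite +-identityʳ (f y + weight f c) = ≤-refl
    ... | true | false rewrite +-identityʳ (f y + weight f c) = ≤-refl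
    ... | true | true = begin
      f (vmerge x y c) + weight f c  ≤⟨ +-monoˡ-≤ _ (f-merge _ x y ok-xy) ⟩
      f x + f y + weight f c         ≡⟨ +-assoc (f x) _ _ ⟩
      f x + (f y + weight f c)       ∎

    hm-≤ : ∀ i j → weights f (hm i j) ≤ itemWeight i + itemWeight j
    hm-≤ i j with resolve true i | resolve true j | resolve-≤ true i | resolve-≤ true j
    ... | (x , c) | (y , d) | x≤i | y≤j with ok x y in ok-xy
    ... | false rewrite +-identityʳ (f y + weight f d) = +-mono-≤ x≤i y≤j
    ... | true = begin
      f (merge (htype i j) x y) + weight f (if leafOf i then d else c) + 0
        ≡⟨ +-identityʳ _ ⟩
      f (merge (htype i j) x y) + weight f (if leafOf i then d else c)
        ≤⟨ +-mono-≤ (f-merge _ x y ok-xy) (kept (leafOf i)) ⟩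
      f x + f y + (weight f c + weight f d)
        ≡⟨ interchange (f x) (f y) (weight f c) (weight f d) ⟩
      f x + weight f c + (f y + weight f d)
        ≤⟨ +-mono-≤ x≤i y≤j ⟩
      itemWeight i + itemWeight j ∎
      where
      -- An `Item` carries no proof that its leaf flag is right, so the discarded subtree is not
      -- known to be empty; discarding it only lowers the weight.
      kept : ∀ b → weight f (if b then d else c) ≤ weight f c + weight f d
      kept true = m≤n+m _ _
      kept false = m≤m+n _ _
      interchange : ∀ a b c d → a + b + (c + d) ≡ a + c + (b + d)
      interchange = solve-∀

    realize-≤ : ∀ ss → weights f (realize ss) ≤ segWeights ss
    realize-≤ [] = z≤n
    realize-≤ (one i ∷ ss) = +-mono-≤ (resolve-≤ false i) (realize-≤ ss)
    realize-≤ (two i j ∷ ss) rewrite weights-++ f (hm i j) (realize ss) =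
      +-mono-≤ (hm-≤ i j) (realize-≤ ss)

    pd-++ : ∀ i j ss → segWeights (pd i j ++ ss) ≡ itemWeight i + (itemWeight j + segWeights ss)
    pd-++ i j ss with leafOf i ∨ leafOf j
    ... | true = +-assoc (itemWeight i) _ _
    ... | false = refl

    pd-≡ : ∀ i j → segWeights (pd i j) ≡ itemWeight i + (itemWeight j + 0)
    pd-≡ i j with leafOf i ∨ leafOf j
    ... | true = +-assoc (itemWeight i) _ _
    ... | false = refl

    plan-≡ : ∀ is → segWeights (plan is) ≡ itemWeights is
    plan-≡ [] = refl
    plan-≡ (i ∷ []) = refl
    plan-≡ (i ∷ j ∷ []) = pd-≡ i j
    plan-≡ (i ∷ j ∷ k ∷ []) with not (leafOf i) ∧ not (leafOf j) ∧ leafOf k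
    ... | true = cong (itemWeight i +_) (+-assoc (itemWeight j) _ _)
    ... | false = pd-++ i j (one k ∷ [])
    plan-≡ (i ∷ j ∷ k ∷ l ∷ is) =
      trans (pd-++ i j (plan (k ∷ l ∷ is)))
        (cong (λ w → itemWeight i + (itemWeight j + w)) (plan-≡ (k ∷ l ∷ is)))

    goSingle-≤ : ∀ x r → resWeight (goSingle x r) ≤ f x + resWeight r
    goSingle-≤ x (even c) = ≤-refl
    goSingle-≤ x (odd y c) with ok x y in ok-xy
    ... | true = begin
      f (vmerge x y c) + weight f c + 0  ≡⟨ +-identityʳ _ ⟩
      f (vmerge x y c) + weight f c      ≤⟨ +-monoˡ-≤ _ (f-merge _ x y ok-xy) ⟩
      f x + f y + weight f c             ≡⟨ +-assoc (f x) _ _ ⟩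
      f x + (f y + weight f c)           ∎
    ... | false
      rewrite +-identityʳ (f y + weight f c) | +-identityʳ (f x + (f y + weight f c)) = ≤-refl

    mutual
      go-≤ : ∀ c → resWeight (go c) ≤ weight f c
      go-≤ (cnode []) = z≤n
      go-≤ (cnode ((x , c) ∷ [])) = begin
        resWeight (goSingle x (go c)) ≤⟨ goSingle-≤ x (go c) ⟩
        f x + resWeight (go c)        ≤⟨ +-monoʳ-≤ (f x) (go-≤ c) ⟩
        f x + weight f c              ≡⟨ +-identityʳ _ ⟨
        f x + weight f c + 0          ∎
      go-≤ (cnode (e ∷ e' ∷ es)) = realize-plan-≤ (e ∷ e' ∷ es)

      goList-≤ : ∀ es → itemWeights (goList es) ≤ weights f es
      goList-≤ [] = z≤n
      goList-≤ ((x , c) ∷ es) = +-mono-≤ (+-monoʳ-≤ (f x) (go-≤ c)) (goList-≤ es)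

      realize-plan-≤ : ∀ es → weights f (realize (plan (goList es))) ≤ weights f es
      realize-plan-≤ es = begin
        weights f (realize (plan (goList es)))  ≤⟨ realize-≤ (plan (goList es)) ⟩
        segWeights (plan (goList es))           ≡⟨ plan-≡ (goList es) ⟩
        itemWeights (goList es)                 ≤⟨ goList-≤ es ⟩
        weights f es                            ∎

    weight-step-≤ : ∀ c → weight f (step c) ≤ weight f c
    weight-step-≤ (cnode es) = realize-plan-≤ es

  hm-nonempty : ∀ i j → 1 ≤ clustersL (hm i j)
  hm-nonempty i j with resolve true i | resolve true j
  ... | (x , c) | (y , d) with ok x y
  ... | true = s≤s z≤n
  ... | false = s≤s z≤n

  pd-++-nonempty : ∀ i j ss → pd i j ++ ss ≢ []
  pd-++-nonempty i j ss with leafOf i ∨ leafOf j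
  ... | true = λ ()
  ... | false = λ ()

  plan-nonempty : ∀ i is → plan (i ∷ is) ≢ []
  plan-nonempty i [] = λ ()
  plan-nonempty i (j ∷ []) with leafOf i ∨ leafOf j
  ... | true = λ ()
  ... | false = λ ()
  plan-nonempty i (j ∷ k ∷ []) with not (leafOf i) ∧ not (leafOf j) ∧ leafOf k
  ... | true = λ ()
  ... | false = pd-++-nonempty i j _
  plan-nonempty i (j ∷ k ∷ l ∷ is) = pd-++-nonempty i j _

  plan-realize-nonempty : ∀ i is → 1 ≤ clustersL (realize (plan (i ∷ is)))
  plan-realize-nonempty i is with plan (i ∷ is) | plan-nonempty i is
  ... | [] | ≢[] = contradiction refl ≢[]
  ... | one j ∷ ss | _ = s≤s z≤n
  ... | two j k ∷ ss | _ rewrite weights-++ (λ _ → 1) (hm j k) (realize ss) =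
    ≤-trans (hm-nonempty j k) (m≤m+n _ _)

  -- With this, fewer than two clusters at the end of a run means exactly one.
  step-nonempty : ∀ c → 1 ≤ clusters c → 1 ≤ clusters (step c)
  step-nonempty (cnode ((x , c) ∷ es)) _ = plan-realize-nonempty _ (goList es)

-- Clusters removed by one iteration

module _ {σ p q t : ℕ} where
  open Step {σ} p q t

  large : TT → ℕ
  large x = if small x then 0 else 1

  -- Measured in eighths of a cluster: a step keeps 7/8 of the clusters, and every large cluster can
  -- block one merge.
  allowance : TT → ℕ
  allowance x = 7 * 1 + 8 * large x

  -- A refused merge leaves one cluster too many; the 8 eighths of a large participant pay for it.
  blocked : ∀ x y → ok x y ≡ false → 1 ≤ large x + large y
  blocked x y ¬ok with small x | small y
  ... | false | _ = s≤s z≤n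
  ... | true | false = s≤s z≤n

  -- Good b r w: the result r for a subtree of total allowance w, a leaf iff b. An inner node saves at
  -- least 4 eighths if no edge is pending, and overdraws at most one if an edge is pending; that edge
  -- then keeps its own large-allowance, for a later merge that it may block.
  data Good : Bool → Res → ℕ → Set where
    leaf : ∀ {w} → Good true (even (cnode [])) w
    even : ∀ {c w} → 8 * clusters c + 4 ≤ w → Good false (even c) w
    odd  : ∀ {x c w} → 8 * (1 + clusters c) + 8 * large x ≤ w + 1 → Good false (odd x c) w

  data GoodItem : Item → ℕ → Set where
    item : ∀ {x b r w} → Good b r w → GoodItem (x , b , r) (allowance x + w)

  data GoodItems : List Item → ℕ → Set where
    []  : GoodItems [] 0
    _∷_ : ∀ {i is k w} → GoodItem i k → GoodItems is w → GoodItems (i ∷ is) (k + w)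

  count : List Seg → ℕ
  count ss = clustersL (realize ss)

  count-++ : ∀ ss ss' → count (ss ++ ss') ≡ count ss + count ss'
  count-++ [] ss' = refl
  count-++ (one i ∷ ss) ss' rewrite count-++ ss ss' = sym (+-assoc (1 + clusters (proj₂ (resolve false i))) _ _)
  count-++ (two i j ∷ ss) ss'
    rewrite weights-++ (λ _ → 1) (hm i j) (realize (ss ++ ss'))
          | weights-++ (λ _ → 1) (hm i j) (realize ss)
          | count-++ ss ss' = sym (+-assoc (clustersL (hm i j)) _ _)

  -- The 3 is the 4 saved inside the subtree less the 1 by which the 7 eighths of the edge fall
  -- short of a cluster. If an edge is pending below, either the vertical merge removes a cluster or
  -- a large one of the two pays.
  one-nonleaf : ∀ {i k} → GoodItem i k → leafOf i ≡ false → 8 * count (one i ∷ []) + 3 ≤ k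
  one-nonleaf (item {x} {w = w} (even {c} h)) _ = ≤-by (8 * large x) h (eq (clusters c) w (large x))
    where
    eq : ∀ c w l → 8 * (1 + c + 0) + 3 + w + 8 * l ≡ 7 * 1 + 8 * l + w + (8 * c + 4)
    eq = solve-∀
  one-nonleaf (item {x} {w = w} (odd {y} {c} h)) _ with ok x y in ok-xy
  ... | true = ≤-by (3 + 8 * large x + 8 * large y) h (eq (clusters c) w (large x) (large y))
    where
    eq : ∀ c w l l' → 8 * (1 + c + 0) + 3 + (w + 1) + (3 + 8 * l + 8 * l')
                    ≡ 7 * 1 + 8 * l + w + (8 * (1 + c) + 8 * l')
    eq = solve-∀
  ... | false = ≤-by 3 (+-mono-≤ h (*-monoʳ-≤ 8 (blocked x y ok-xy)))
      (eq (clusters c) w (large x) (large y))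
    where
    eq : ∀ c w l l' → 8 * (1 + (1 + c + 0) + 0) + 3 + ((w + 1) + 8 * (l + l')) + 3
                    ≡ 7 * 1 + 8 * l + w + (8 * (1 + c) + 8 * l' + 8 * 1)
    eq = solve-∀

  -- The worst case is an edge to a leaf: it costs 8 against an allowance of 7.
  one-any : ∀ {i k} → GoodItem i k → 8 * count (one i ∷ []) ≤ k + 1
  one-any (item {x} {w = w} leaf) = ≤-by {X = 0} {Y = 0} (8 * large x + w) z≤n (eq w (large x))
    where
    eq : ∀ w l → 8 * 1 + 0 + (8 * l + w) ≡ 7 * 1 + 8 * l + w + 1 + 0
    eq = solve-∀
  one-any {i} {k} g@(item (even _)) = ≤-by 4 (one-nonleaf g refl) (eq (count (one i ∷ [])) k)
    where
    eq : ∀ c k → 8 * c + k + 4 ≡ k + 1 + (8 * c + 3)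
    eq = solve-∀
  one-any {i} {k} g@(item (odd _)) = ≤-by 4 (one-nonleaf g refl) (eq (count (one i ∷ [])) k)
    where
    eq : ∀ c k → 8 * c + k + 4 ≡ k + 1 + (8 * c + 3)
    eq = solve-∀

  below : Item → CT
  below i = proj₂ (resolve true i)

  resolve-true : ∀ x b r → proj₁ (resolve true (x , b , r)) ≡ x
  resolve-true x b (even _) = refl
  resolve-true x b (odd _ _) = refl

  -- In a horizontal pair a pending edge stays unmerged, so the overdraft of `odd` remains.
  below-≤ : ∀ {x b r w} → Good b r w → 8 * clusters (below (x , b , r)) ≤ w + 1
  below-≤ leaf = z≤n
  below-≤ {w = w} (even {c} h) = ≤-by 5 h (eq (clusters c) w)
    where
    eq : ∀ c w → 8 * c + w + 5 ≡ w + 1 + (8 * c + 4)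
    eq = solve-∀
  below-≤ {w = w} (odd {y} {c} h) = ≤-by (8 * large y) h (eq (clusters c) w (large y))
    where
    eq : ∀ c w l → 8 * (1 + c + 0) + (w + 1) + 8 * l ≡ w + 1 + (8 * (1 + c) + 8 * l)
    eq = solve-∀

  below-leaf : ∀ {x r w} → Good true r w → clusters (below (x , true , r)) ≡ 0
  below-leaf leaf = refl

  -- One of the two items is a leaf, so only one of them has anything below it.
  below-pair : ∀ {x b r w y b' r' w'} → Good b r w → Good b' r' w' → b ∨ b' ≡ true →
    8 * (clusters (below (x , b , r)) + clusters (below (y , b' , r'))) ≤ w + w' + 1
  below-pair {x} {true} {w = w} {w' = w'} g g' _ rewrite below-leaf {x} g =
    ≤-trans (below-≤ g') (+-monoˡ-≤ 1 (m≤n+m w' w))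
  below-pair {x} {false} {r} {w} {y} {w' = w'} g leaf _
    rewrite +-identityʳ (clusters (below (x , false , r))) =
    ≤-trans (below-≤ {x} g) (+-monoˡ-≤ 1 (m≤m+n w w'))

  -- The two edges bring 14 eighths, the merged edge costs 8, and the one nonempty subtree overdraws
  -- by at most 1, which leaves 5. A refused merge costs 8 more, paid by a large cluster.
  hm-good : ∀ {i j k k'} → GoodItem i k → GoodItem j k' → leafOf i ∨ leafOf j ≡ true →
    8 * clustersL (hm i j) + 5 ≤ k + k'
  hm-good (item {x} {b} {r} {w} g) (item {y} {b'} {r'} {w'} g') eq
    with resolve true (x , b , r) | resolve true (y , b' , r')
       | resolve-true x b r | resolve-true y b' r' | below-pair {x} {y = y} g g' eq
  ... | (_ , c) | (_ , c') | refl | refl | h with ok x y in ok-xy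
  ... | true = ≤-by (8 * large x + 8 * large y)
      (≤-trans (*-monoʳ-≤ 8 (kept b)) h) (eq' (clusters (if b then c' else c)) w w' (large x) (large y))
    where
    kept : ∀ b → clusters (if b then c' else c) ≤ clusters c + clusters c'
    kept true = m≤n+m _ _
    kept false = m≤m+n _ _
    eq' : ∀ c w w' l l' → 8 * (1 + c + 0) + 5 + (w + w' + 1) + (8 * l + 8 * l')
                        ≡ 7 * 1 + 8 * l + w + (7 * 1 + 8 * l' + w') + 8 * c
    eq' = solve-∀
  ... | false = ≤-by 0 (+-mono-≤ h (*-monoʳ-≤ 8 (blocked x y ok-xy)))
      (eq' (clusters c) (clusters c') w w' (large x) (large y))
    where
    eq' : ∀ c c' w w' l l' → 8 * (1 + c + (1 + c' + 0)) + 5 + (w + w' + 1 + 8 * (l + l')) + 0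
                           ≡ 7 * 1 + 8 * l + w + (7 * 1 + 8 * l' + w') + (8 * (c + c') + 8 * 1)
    eq' = solve-∀

  two-good : ∀ {i j k k'} → GoodItem i k → GoodItem j k' → leafOf i ∨ leafOf j ≡ true →
    8 * count (two i j ∷ []) + 5 ≤ k + k'
  two-good {i} {j} g g' eq rewrite weights-++ (λ _ → 1) (hm i j) [] | +-identityʳ (clustersL (hm i j)) =
    hm-good g g' eq

  add-good : ∀ ss ss' {k w} a b → 8 * count ss + a ≤ k → 8 * count ss' + b ≤ w →
    8 * count (ss ++ ss') + (a + b) ≤ k + w
  add-good ss ss' {k} {w} a b h h' rewrite count-++ ss ss' =
    ≤-by 0 (+-mono-≤ h h') (eq (count ss) (count ss') a b k w)
    where
    eq : ∀ c c' a b k w → 8 * (c + c') + (a + b) + (k + w) + 0 ≡ k + w + (8 * c + a + (8 * c' + b))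
    eq = solve-∀

  weaken : ∀ ss {k} a b → 8 * count ss + (b + a) ≤ k → 8 * count ss + a ≤ k
  weaken ss a b = ≤-trans (+-monoʳ-≤ (8 * count ss) (m≤n+m a b))

  pd-good : ∀ {i j k k'} → GoodItem i k → GoodItem j k' → 8 * count (pd i j) + 5 ≤ k + k'
  pd-good {i} {j} g g' with leafOf i in li | leafOf j in lj
  ... | true | b' = two-good g g' (cong₂ _∨_ li lj)
  ... | false | true = two-good g g' (cong₂ _∨_ li lj)
  ... | false | false =
    weaken (one i ∷ one j ∷ []) 5 1 (add-good (one i ∷ []) (one j ∷ []) 3 3 (one-nonleaf g li) (one-nonleaf g' lj))

  plan₃-condition : ∀ a b c → not a ∧ not b ∧ c ≡ true → a ≡ false × c ≡ true
  plan₃-condition false false true _ = refl , refl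

  -- A pair that saves 5 followed by a single edge that overdraws 1 is the origin of the 4 in
  -- `even`.
  plan₃-good : ∀ {i₁ i₂ i₃ k₁ k₂ k₃} → GoodItem i₁ k₁ → GoodItem i₂ k₂ → GoodItem i₃ k₃ →
    8 * count (plan (i₁ ∷ i₂ ∷ i₃ ∷ [])) + 4 ≤ k₁ + (k₂ + k₃)
  plan₃-good {i₁} {i₂} {i₃} {k₁} {k₂} {k₃} g₁ g₂ g₃
    with not (leafOf i₁) ∧ not (leafOf i₂) ∧ leafOf i₃ in c
  ... | true = let ¬l₁ , l₃ = plan₃-condition _ (leafOf i₂) _ c in
    weaken (one i₁ ∷ two i₂ i₃ ∷ []) 4 4 (add-good (one i₁ ∷ []) (two i₂ i₃ ∷ []) 3 5 (one-nonleaf g₁ ¬l₁)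
      (two-good g₂ g₃ (trans (cong (leafOf i₂ ∨_) l₃) (∨-zeroʳ (leafOf i₂)))))
  ... | false rewrite count-++ (pd i₁ i₂) (one i₃ ∷ []) =
    ≤-by 0 (+-mono-≤ (pd-good g₁ g₂) (one-any g₃)) (eq (count (pd i₁ i₂)) (count (one i₃ ∷ [])) k₁ k₂ k₃)
    where
    eq : ∀ c c' k₁ k₂ k₃ → 8 * (c + c') + 4 + (k₁ + k₂ + (k₃ + 1)) + 0
                         ≡ k₁ + (k₂ + k₃) + (8 * c + 5 + 8 * c')
    eq = solve-∀

  plan-good : ∀ {i j is w} → GoodItems (i ∷ j ∷ is) w → 8 * count (plan (i ∷ j ∷ is)) + 4 ≤ w
  plan-good {i} {j} (_∷_ {k = k} g (_∷_ {k = k'} g' [])) rewrite +-identityʳ k' =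
    weaken (pd i j) 4 1 (pd-good g g')
  plan-good (g ∷ g' ∷ (_∷_ {k = k″} g″ [])) rewrite +-identityʳ k″ = plan₃-good g g' g″
  plan-good {i} {j} {i″ ∷ i‴ ∷ is} (_∷_ {k = k} g (_∷_ {k = k'} {w = w} g' gs@(_ ∷ _ ∷ _))) =
    subst (8 * count (plan (i ∷ j ∷ i″ ∷ i‴ ∷ is)) + 4 ≤_) (+-assoc k k' w)
      (weaken (pd i j ++ plan (i″ ∷ i‴ ∷ is)) 4 5
        (add-good (pd i j) (plan (i″ ∷ i‴ ∷ is)) 5 4 (pd-good g g') (plan-good gs)))

  -- The overdraft in `odd` stems from an edge to a leaf. The next edge up repays it, by merging
  -- with the pending edge or, if that is refused, from the allowance of a large one of the two.
  goSingle-good : ∀ {b r w} x → Good b r w → Good false (goSingle x r) (allowance x + w + 0)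
  goSingle-good {w = w} x leaf = odd (≤-by w ≤-refl (eq w (large x)))
    where
    eq : ∀ w l → 8 * 1 + 8 * l + 0 + w ≡ 7 * 1 + 8 * l + w + 0 + 1 + 0
    eq = solve-∀
  goSingle-good {w = w} x (even {c} h) = odd (≤-by 4 h (eq (clusters c) w (large x)))
    where
    eq : ∀ c w l → 8 * (1 + c) + 8 * l + w + 4 ≡ 7 * 1 + 8 * l + w + 0 + 1 + (8 * c + 4)
    eq = solve-∀
  goSingle-good {w = w} x (odd {y} {c} h) with ok x y in ok-xy
  ... | true = even (≤-by (2 + 8 * large x + 8 * large y) h (eq (clusters c) w (large x) (large y)))
    where
    eq : ∀ c w l l' → 8 * (1 + c + 0) + 4 + (w + 1) + (2 + 8 * l + 8 * l')
                    ≡ 7 * 1 + 8 * l + w + 0 + (8 * (1 + c) + 8 * l')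
    eq = solve-∀
  ... | false = even (≤-by 2 (+-mono-≤ h (*-monoʳ-≤ 8 (blocked x y ok-xy)))
      (eq (clusters c) w (large x) (large y)))
    where
    eq : ∀ c w l l' → 8 * (1 + (1 + c + 0) + 0) + 4 + (w + 1 + 8 * (l + l')) + 2
                    ≡ 7 * 1 + 8 * l + w + 0 + (8 * (1 + c) + 8 * l' + 8 * 1)
    eq = solve-∀

  mutual
    go-good : ∀ c → Good (isLeaf c) (go c) (weight allowance c)
    go-good (cnode []) = leaf
    go-good (cnode ((x , c) ∷ [])) = goSingle-good x (go-good c)
    go-good (cnode (e ∷ e' ∷ es)) = even (plan-good (goList-good (e ∷ e' ∷ es)))

    goList-good : ∀ es → GoodItems (goList es) (weights allowance es)
    goList-good [] = []
    goList-good ((x , c) ∷ es) = item (go-good c) ∷ goList-good es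

  -- The final 1 is attained by a tree that consists of a single small cluster.
  clusters-step : ∀ T → 8 * clusters (step T) ≤ 7 * clusters T + 8 * weight large T + 1
  clusters-step T@(cnode es) =
    subst (λ w → 8 * clusters (step T) ≤ w + 1) (weight-linear 7 8 (λ _ → 1) large T) (bound es)
    where
    bound : ∀ es → 8 * clusters (step (cnode es)) ≤ weights allowance es + 1
    bound [] = z≤n
    bound ((x , c) ∷ []) = subst (λ w → 8 * clusters (step (cnode ((x , c) ∷ []))) ≤ w + 1)
      (sym (+-identityʳ (allowance x + weight allowance c))) (one-any (item {x} (go-good c)))
    bound (e ∷ e' ∷ es) =
      ≤-trans (m+n≤o⇒m≤o _ (plan-good (goList-good (e ∷ e' ∷ es)))) (m≤m+n _ 1)

-- Counting distinct small top trees

length-⊆ : ∀ {A : Set} {xs ys : List A} → Unique xs → xs ⊆ ys → length xs ≤ length ys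
length-⊆ [] _ = z≤n
length-⊆ {xs = x ∷ xs} (x∉xs ∷ u) x∷xs⊆ys with ∈-∃++ (x∷xs⊆ys (here refl))
... | as , bs , refl = begin
  suc (length xs)            ≤⟨ s≤s (length-⊆ u (λ z∈xs → avoid (All.lookup x∉xs z∈xs) (x∷xs⊆ys (there z∈xs)))) ⟩
  suc (length (as ++ bs))    ≡⟨ cong suc (length-++ as) ⟩
  suc (length as + length bs) ≡⟨ +-suc (length as) (length bs) ⟨
  length as + length (x ∷ bs) ≡⟨ length-++ as ⟨
  length (as ++ x ∷ bs)      ∎
  where
  avoid : ∀ {z} → x ≢ z → z ∈ as ++ x ∷ bs → z ∈ as ++ bs
  avoid x≢z z∈ with ∈-++⁻ as z∈
  ... | inj₁ z∈as = ∈-++⁺ˡ z∈as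
  ... | inj₂ (here refl) = contradiction refl x≢z
  ... | inj₂ (there z∈bs) = ∈-++⁺ʳ as z∈bs

length-cartesianProductWith : ∀ {A B C : Set} (f : A → B → C) xs ys →
  length (cartesianProductWith f xs ys) ≡ length xs * length ys
length-cartesianProductWith f [] ys = refl
length-cartesianProductWith f (x ∷ xs) ys = trans (length-++ (map (f x) ys))
  (cong₂ _+_ (length-map (f x) ys) (length-cartesianProductWith f xs ys))

module _ {σ : ℕ} where

  mergeHead : ∀ {k} → MergeType → Vec (TopTree σ) (2 + k) → Vec (TopTree σ) (1 + k)
  mergeHead m (l ∷ r ∷ ts) = merge m l r ∷ ts

  leafCons : ∀ {k} → Fin σ × Fin σ → Vec (TopTree σ) k → Vec (TopTree σ) (1 + k)
  leafCons (a , b) ts = leaf a b ∷ ts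

  -- All sequences of k top trees with at most w nodes altogether. Reading them off in preorder,
  -- each node is one of σ² + 5 symbols, which bounds their number by (σ² + 5) ^ w.
  forests : (w k : ℕ) → List (Vec (TopTree σ) k)
  forests w zero = [] ∷ []
  forests zero (suc k) = []
  forests (suc w) (suc k) =
    cartesianProductWith leafCons (cartesianProduct (allFin σ) (allFin σ)) (forests w k)
    ++ cartesianProductWith mergeHead (allFin 5) (forests w (2 + k))

  length-forests : ∀ w k → length (forests w k) ≤ (σ * σ + 5) ^ w
  length-forests w zero = m^n>0 (σ * σ + 5) {{nonZero}} w
    where
    nonZero : NonZero (σ * σ + 5)
    nonZero rewrite +-comm (σ * σ) 5 = _
  length-forests zero (suc k) = z≤n
  length-forests (suc w) (suc k) = begin
    length (cartesianProductWith leafCons pairs (forests w k)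
            ++ cartesianProductWith mergeHead (allFin 5) (forests w (2 + k)))
      ≡⟨ length-++ (cartesianProductWith leafCons pairs (forests w k)) ⟩
    length (cartesianProductWith leafCons pairs (forests w k))
      + length (cartesianProductWith mergeHead (allFin 5) (forests w (2 + k)))
      ≡⟨ cong₂ _+_ (length-cartesianProductWith leafCons pairs (forests w k))
                   (length-cartesianProductWith mergeHead (allFin 5) (forests w (2 + k))) ⟩
    length pairs * length (forests w k) + 5 * length (forests w (2 + k))
      ≡⟨ cong (λ n → n * length (forests w k) + 5 * length (forests w (2 + k))) length-pairs ⟩
    σ * σ * length (forests w k) + 5 * length (forests w (2 + k))
      ≤⟨ +-mono-≤ (*-monoʳ-≤ (σ * σ) (length-forests w k)) (*-monoʳ-≤ 5 (length-forests w (2 + k))) ⟩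
    σ * σ * (σ * σ + 5) ^ w + 5 * (σ * σ + 5) ^ w
      ≡⟨ *-distribʳ-+ ((σ * σ + 5) ^ w) (σ * σ) 5 ⟨
    (σ * σ + 5) * (σ * σ + 5) ^ w ∎
    where
    pairs = cartesianProduct (allFin σ) (allFin σ)
    length-pairs : length pairs ≡ σ * σ
    length-pairs = trans (length-cartesianProductWith _,_ (allFin σ) (allFin σ))
      (cong₂ _*_ (length-tabulate {n = σ} _) (length-tabulate {n = σ} _))

  nodes : TopTree σ → ℕ
  nodes (leaf _ _) = 1
  nodes (merge _ l r) = 1 + (nodes l + nodes r)

  nodesᵛ : ∀ {k} → Vec (TopTree σ) k → ℕ
  nodesᵛ [] = 0
  nodesᵛ (t ∷ ts) = nodes t + nodesᵛ ts

  ∈-forests : ∀ w {k} (ts : Vec (TopTree σ) k) → nodesᵛ ts ≤ w → ts ∈ forests w k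
  ∈-forests w [] _ = here refl
  ∈-forests (suc w) (leaf a b ∷ ts) (s≤s h) = ∈-++⁺ˡ
    (∈-cartesianProductWith⁺ leafCons (∈-cartesianProduct⁺ (∈-allFin a) (∈-allFin b)) (∈-forests w ts h))
  ∈-forests (suc w) {suc k} (merge m l r ∷ ts) (s≤s h) = ∈-++⁺ʳ
    (cartesianProductWith leafCons (cartesianProduct (allFin σ) (allFin σ)) (forests w k))
    (∈-cartesianProductWith⁺ mergeHead (∈-allFin m) (∈-forests w (l ∷ r ∷ ts)
      (subst (_≤ w) (+-assoc (nodes l) (nodes r) (nodesᵛ ts)) h)))

  nodes-edges : ∀ t → 1 + nodes t ≡ 2 * edges t
  nodes-edges (leaf _ _) = refl
  nodes-edges (merge _ l r) = trans (shift (nodes l) (nodes r))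
    (trans (cong₂ _+_ (nodes-edges l) (nodes-edges r)) (sym (*-distribˡ-+ 2 (edges l) (edges r))))
    where
    shift : ∀ a b → 1 + (1 + (a + b)) ≡ 1 + a + (1 + b)
    shift = solve-∀

  nodes≤2*edges : ∀ t → nodes t ≤ 2 * edges t
  nodes≤2*edges t = ≤-trans (n≤1+n (nodes t)) (≤-reflexive (nodes-edges t))

  length-subtrees : ∀ t → length (subtrees t) ≡ nodes t
  length-subtrees (leaf _ _) = refl
  length-subtrees (merge _ l r) = cong suc (trans (length-++ (subtrees l))
    (cong₂ _+_ (length-subtrees l) (length-subtrees r)))

  dagSize≤2*edges : ∀ t → dagSize t ≤ 2 * edges t
  dagSize≤2*edges t = begin
    dagSize t              ≤⟨ length-deduplicate _≟T_ (subtrees t) ⟩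
    length (subtrees t)    ≡⟨ length-subtrees t ⟩
    nodes t                ≤⟨ nodes≤2*edges t ⟩
    2 * edges t            ∎

  big? : ∀ s (u : TopTree σ) → Dec (s < edges u)
  big? s u = s <? edges u

  bigSubtrees : ℕ → TopTree σ → List (TopTree σ)
  bigSubtrees s t = filter (big? s) (subtrees t)

  bigs : ℕ → TopTree σ → ℕ
  bigs s t = length (bigSubtrees s t)

  bigs-subtrees : ∀ s l r → length (filter (big? s) (subtrees l ++ subtrees r)) ≡ bigs s l + bigs s r
  bigs-subtrees s l r = trans (cong length (filter-++ (big? s) (subtrees l) (subtrees r)))
    (length-++ (bigSubtrees s l))

  bigs-merge-small : ∀ s m l r → edges l + edges r ≤ s → bigs s (merge m l r) ≡ bigs s l + bigs s r
  bigs-merge-small s m l r h = trans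
    (cong length (filter-reject (big? s) {merge m l r} {subtrees l ++ subtrees r} (≤⇒≯ h)))
    (bigs-subtrees s l r)

  bigs-merge : ∀ s m l r → bigs s (merge m l r) ≤ 1 + (bigs s l + bigs s r)
  bigs-merge s m l r with s <? edges l + edges r
  ... | no ¬big = ≤-trans (≤-reflexive (bigs-merge-small s m l r (≮⇒≥ ¬big))) (n≤1+n _)
  ... | yes big = ≤-reflexive (trans
    (cong length (filter-accept (big? s) {merge m l r} {subtrees l ++ subtrees r} big))
    (cong suc (bigs-subtrees s l r)))

  bigs-leaf : ∀ s a b → 1 ≤ s → bigs s (leaf a b) ≡ 0
  bigs-leaf s a b 1≤s = cong length (filter-reject (big? s) {leaf a b} {[]} (≤⇒≯ 1≤s))

  dagSize-≤ : ∀ s t → dagSize t ≤ bigs s t + (σ * σ + 5) ^ (2 * s)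
  dagSize-≤ s t = begin
    dagSize t
      ≤⟨ length-⊆ (Unique.deduplicate-! _≟T_ (subtrees t)) covered ⟩
    length (bigSubtrees s t ++ smallTrees)
      ≡⟨ length-++ (bigSubtrees s t) ⟩
    bigs s t + length smallTrees
      ≡⟨ cong (bigs s t +_) (length-map Vec.head (forests (2 * s) 1)) ⟩
    bigs s t + length (forests (2 * s) 1)
      ≤⟨ +-monoʳ-≤ (bigs s t) (length-forests (2 * s) 1) ⟩
    bigs s t + (σ * σ + 5) ^ (2 * s) ∎
    where
    smallTrees = map Vec.head (forests (2 * s) 1)
    covered : deduplicate _≟T_ (subtrees t) ⊆ bigSubtrees s t ++ smallTrees
    covered {u} u∈ with s <? edges u
    ... | yes big = ∈-++⁺ˡ (∈-filter⁺ (big? s) (∈-deduplicate⁻ _≟T_ (subtrees t) u∈) big)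
    ... | no ¬big = ∈-++⁺ʳ (bigSubtrees s t) (∈-map⁺ Vec.head (∈-forests (2 * s) (u ∷ []) (begin
      nodes u + 0  ≡⟨ +-identityʳ (nodes u) ⟩
      nodes u      ≤⟨ nodes≤2*edges u ⟩
      2 * edges u  ≤⟨ *-monoʳ-≤ 2 (≮⇒≥ ¬big) ⟩
      2 * s        ∎)))

-- Weights along a run

module _ {σ : ℕ} (f : TopTree σ → ℕ) (c : ℕ) (f-leaf : ∀ a b → f (leaf a b) ≡ c) where
  mutual
    -- A tree has one edge fewer than nodes; the missing `c` stands on the left to avoid
    -- subtraction.
    weight-initT : ∀ T → weight f (initT T) + c ≡ c * nodeCount T
    weight-initT (node a ts) = trans (cong (_+ c) (weights-initL a ts))
      (trans (+-comm _ c) (sym (*-suc c (nodeCountList ts))))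

    weights-initL : ∀ a ts → weights f (initL a ts) ≡ c * nodeCountList ts
    weights-initL a [] = sym (*-zeroʳ c)
    weights-initL a (t ∷ ts) rewrite f-leaf a (label t) | weights-initL a ts =
      trans (cong (_+ c * nodeCountList ts) (trans (+-comm c _) (weight-initT t)))
        (sym (*-distribˡ-+ c (nodeCount t) (nodeCountList ts)))

module _ {σ : ℕ} (p q : ℕ) where

  -- `runFrom` peels off the first iteration, whereas the bounds on runs are proved by appending a
  -- last one.
  runFrom-snoc : ∀ t k (T : CTree σ) → runFrom p q t (suc k) T ≡ Step.step p q (t + k) (runFrom p q t k T)
  runFrom-snoc t zero T rewrite +-identityʳ t = refl
  runFrom-snoc t (suc k) T rewrite +-suc t k = runFrom-snoc (suc t) k (Step.step p q t T)

  run-suc : ∀ k (T : CTree σ) → run p q (suc k) T ≡ Step.step p q (suc k) (run p q k T)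
  run-suc = runFrom-snoc 1

  run-nonempty : ∀ k (T : CTree σ) → 1 ≤ clusters T → 1 ≤ clusters (run p q k T)
  run-nonempty zero T h = h
  run-nonempty (suc k) T h rewrite run-suc k T =
    step-nonempty {p = p} {q} {suc k} (run p q k T) (run-nonempty k T h)

  -- The restriction to `t ≤ j + k` is for `bigs s`, controlled only up to the threshold; the
  -- starting point `j` lets charging begin after it.
  run-≤ : ∀ (f : TopTree σ → ℕ) j k →
    (∀ t → t ≤ j + k → ∀ m x y → Step.ok p q t x y ≡ true → f (merge m x y) ≤ f x + f y) →
    ∀ T → weight f (run p q (j + k) T) ≤ weight f (run p q j T)
  run-≤ f j zero f-merge T rewrite +-identityʳ j = ≤-refl
  run-≤ f j (suc k) f-merge T rewrite +-suc j k | run-suc (j + k) T = ≤-trans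
    (Subadditive.weight-step-≤ {p = p} {q} {suc (j + k)} f (f-merge (suc (j + k)) ≤-refl) (run p q (j + k) T))
    (run-≤ f j k (λ t t≤ → f-merge t (m≤n⇒m≤1+n t≤)) T)

  ok-≤ : ∀ t (x y : TopTree σ) → Step.ok p q t x y ≡ true → edges x * q ^ t ≤ p ^ t × edges y * q ^ t ≤ p ^ t
  ok-≤ t x y _ with edges x * q ^ t ≤ᵇ p ^ t in hx | edges y * q ^ t ≤ᵇ p ^ t in hy
  ... | true | true = ≤ᵇ⇒≤ _ _ (subst T (sym hx) _) , ≤ᵇ⇒≤ _ _ (subst T (sym hy) _)

  -- Markov's inequality for a single cluster; summation bounds the number of large ones by n/α^t.
  large-≤ : ∀ t (x : TopTree σ) → large {p = p} {q} {t} x * p ^ t ≤ edges x * q ^ t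
  large-≤ t x with edges x * q ^ t ≤ᵇ p ^ t in h
  ... | true = z≤n
  ... | false rewrite +-identityʳ (p ^ t) = ≰⇒≥ (λ ≤ → subst T h (≤⇒≤ᵇ ≤))

-- Logarithms and the growth of (10/9)^t

2^⌊log₂n⌋≤n : ∀ n → 1 ≤ n → 2 ^ ⌊log₂ n ⌋ ≤ n
2^⌊log₂n⌋≤n n = go n (<-wellFounded n)
  where
  -- The logarithm recurses on an accessibility proof, so the induction is over an arbitrary one.
  go : ∀ n (a : Acc _<_ n) → 1 ≤ n → 2 ^ ⌊log2⌋ n a ≤ n
  go 1 _ _ = ≤-refl
  go (suc (suc n)) (acc rs) _ = begin
    2 * 2 ^ ⌊log2⌋ (suc ⌊ n /2⌋) _           ≤⟨ *-monoʳ-≤ 2 (go (suc ⌊ n /2⌋) _ (s≤s z≤n)) ⟩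
    2 * suc ⌊ n /2⌋                          ≡⟨ double ⌊ n /2⌋ ⟩
    2 + (⌊ n /2⌋ + ⌊ n /2⌋)                  ≤⟨ +-monoʳ-≤ 2 (+-monoʳ-≤ ⌊ n /2⌋ (⌊n/2⌋≤⌈n/2⌉ n)) ⟩
    2 + (⌊ n /2⌋ + ⌈ n /2⌉)                  ≡⟨ cong (2 +_) (⌊n/2⌋+⌈n/2⌉≡n n) ⟩
    2 + n                                    ∎
    where
    double : ∀ m → 2 * suc m ≡ 2 + (m + m)
    double = solve-∀

n≤2^⌈log₂n⌉ : ∀ n → n ≤ 2 ^ ⌈log₂ n ⌉
n≤2^⌈log₂n⌉ n = go n (<-wellFounded n)
  where
  go : ∀ n (a : Acc _<_ n) → n ≤ 2 ^ ⌈log2⌉ n a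
  go 0 _ = z≤n
  go 1 _ = ≤-refl
  go (suc (suc n)) (acc rs) = begin
    2 + n                                    ≡⟨ cong (2 +_) (⌊n/2⌋+⌈n/2⌉≡n n) ⟨
    2 + (⌊ n /2⌋ + ⌈ n /2⌉)                  ≤⟨ +-monoʳ-≤ 2 (+-monoˡ-≤ ⌈ n /2⌉ (⌊n/2⌋≤⌈n/2⌉ n)) ⟩
    2 + (⌈ n /2⌉ + ⌈ n /2⌉)                  ≡⟨ double ⌈ n /2⌉ ⟨
    2 * suc ⌈ n /2⌉                          ≤⟨ *-monoʳ-≤ 2 (go (suc ⌈ n /2⌉) _) ⟩
    2 * 2 ^ ⌈log2⌉ (suc ⌈ n /2⌉) _           ∎
    where
    double : ∀ m → 2 * suc m ≡ 2 + (m + m)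
    double = solve-∀

-- Bernoulli's inequality (1 + 1/9)^t ≥ 1 + t/9 without denominators.
bernoulli : ∀ t → 9 ^ t * (9 + t) ≤ 9 * 10 ^ t
bernoulli zero = ≤-refl
bernoulli (suc t) = ≤-by (9 ^ t * t) (*-monoʳ-≤ 10 (bernoulli t)) (eq (9 ^ t) (10 ^ t) t)
  where
  eq : ∀ a b t → 9 * a * (10 + t) + 10 * (9 * b) + a * t ≡ 9 * (10 * b) + 10 * (a * (9 + t))
  eq = solve-∀

-- The free summand `j` allows a run to end beyond any prescribed iteration.
power-exceeds : ∀ c j → c * 9 ^ (j + 9 * c) < 10 ^ (j + 9 * c)
power-exceeds c j = *-cancelˡ-< 9 _ _ (begin-strict
  9 * (c * 9 ^ t)       <⟨ m<m+n _ (*-mono-≤ (m^n>0 9 t) (m≤m+n 1 (8 + j))) ⟩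
  9 * (c * 9 ^ t) + 9 ^ t * (9 + j)  ≡⟨ eq (9 ^ t) c j ⟩
  9 ^ t * (9 + t)       ≤⟨ bernoulli t ⟩
  9 * 10 ^ t            ∎)
  where
  t = j + 9 * c
  eq : ∀ a c j → 9 * (c * a) + a * (9 + j) ≡ a * (9 + (j + 9 * c))
  eq = solve-∀

-- Iterations up to t create no cluster of size above 2 (10/9)^t ≤ s, and up to a constant factor t is
-- the last such iteration.
threshold : ∀ s → 2 ≤ s → Σ ℕ λ t → 2 * 10 ^ t ≤ s * 9 ^ t × s * 9 ^ t ≤ 3 * 10 ^ t
threshold s 2≤s = search (9 * s) (≤-trans (power-exceeds s 0) (m≤m+n _ _))
  where
  search : ∀ t → s * 9 ^ t < 2 * 10 ^ t → Σ ℕ λ t → 2 * 10 ^ t ≤ s * 9 ^ t × s * 9 ^ t ≤ 3 * 10 ^ t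
  search zero h = contradiction (subst₂ _<_ (*-identityʳ s) refl h) (≤⇒≯ 2≤s)
  search (suc t) h with 2 * 10 ^ t ≤? s * 9 ^ t
  ... | no ¬le = search t (≰⇒> ¬le)
  -- Failure at `suc t` gives s (9/10)^t < 20/9, which is rounded up to 3.
  ... | yes le = t , le , *-cancelˡ-≤ 9 (≤-by (7 * 10 ^ t) (<⇒≤ h) (eq s (9 ^ t) (10 ^ t)))
    where
    eq : ∀ s a b → 9 * (s * a) + 2 * (10 * b) + 7 * b ≡ 9 * (3 * b) + s * (9 * a)
    eq = solve-∀

-- Clusters and big subtrees in the run with α = 10/9

module Bounds {σ : ℕ} (T : Tree (Fin σ)) (n : ℕ) (n-edges : nodeCount T ≡ suc n) where

  state : ℕ → CTree σ
  state t = run 10 9 t (initT T)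

  initial-weight : ∀ f c → (∀ a b → f (leaf a b) ≡ c) → weight f (initT T) ≡ c * n
  initial-weight f c f-leaf = +-cancelʳ-≡ c _ _ (trans (weight-initT f c f-leaf T)
    (trans (cong (c *_) n-edges) (trans (*-suc c n) (+-comm c _))))

  edges-≤ : ∀ t → weight edges (state t) ≤ n
  edges-≤ t = ≤-trans (run-≤ 10 9 edges 0 t (λ _ _ _ _ _ _ → ≤-refl) (initT T))
    (≤-reflexive (trans (initial-weight edges 1 (λ _ _ → refl)) (*-identityˡ n)))

  -- From m' ≤ 7/8 m + L + 1/8 with L ≤ n (9/10)^t, as 7/8 · 10/9 < 1.
  clusters-≤ : ∀ t → clusters (state t) * 10 ^ t ≤ 36 * n * 9 ^ t + 10 ^ t
  clusters-≤ zero rewrite initial-weight (λ _ → 1) 1 (λ _ _ → refl) =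
    ≤-by {X = 0} {Y = 0} (35 * n + 1) z≤n (eq n)
    where
    eq : ∀ n → 1 * n * 1 + 0 + (35 * n + 1) ≡ 36 * n * 1 + 1 + 0
    eq = solve-∀
  -- For a bound A n (9/10)^t + 1 the induction requires 7/8 A + 9/10 ≤ 9/10 A, so A = 36 is the
  -- least choice; the summand 1 is the fixed point of m ↦ 7/8 m + 1/8.
  clusters-≤ (suc t) rewrite run-suc 10 9 t (initT T) = *-cancelˡ-≤ 8
    (≤-by 0 (+-mono-≤ (+-mono-≤
      (*-monoˡ-≤ (10 * 10 ^ t) (clusters-step {p = 10} {9} {suc t} (state t)))
      (*-monoʳ-≤ 70 (clusters-≤ t)))
      (*-monoʳ-≤ 8 large-bound))
      (eq (clusters (Step.step 10 9 (suc t) (state t))) (clusters (state t))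
          (weight (large {p = 10} {9} {suc t}) (state t)) (10 ^ t) (9 ^ t) n))
    where
    large-bound : weight (large {p = 10} {9} {suc t}) (state t) * 10 ^ suc t ≤ n * 9 ^ suc t
    large-bound = ≤-trans
      (weight-mono (10 ^ suc t) (9 ^ suc t) (large-≤ 10 9 (suc t)) (state t))
      (*-monoˡ-≤ (9 ^ suc t) (edges-≤ t))
    eq : ∀ m' m l a b n →
      8 * (m' * (10 * a))
        + ((7 * m + 8 * l + 1) * (10 * a) + 70 * (36 * n * b + a) + 8 * (n * (9 * b))) + 0
      ≡ 8 * (36 * n * (9 * b) + 10 * a)
        + (8 * m' * (10 * a) + 70 * (m * a) + 8 * (l * (10 * a)))
    eq = solve-∀

  single : ∀ c → clusters c ≤ 1 → 1 ≤ clusters c → Σ (TopTree σ) λ tt → c ≡ singleCluster tt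
  single (cnode ((tt , cnode []) ∷ [])) _ _ = tt , refl
  single (cnode ((_ , cnode (_ ∷ _)) ∷ _)) (s≤s ()) _
  single (cnode ((_ , cnode []) ∷ (_ ∷ _))) (s≤s ()) _

  -- After this many iterations the first summand of `clusters-≤` has dropped below one cluster. A
  -- step leaves a single cluster as it is, so a longer run does no harm.
  finished : ∀ j → 1 ≤ n → Σ (TopTree σ) λ tt → state (j + 9 * (36 * n)) ≡ singleCluster tt
  finished j 1≤n = single (state k) (≤-pred (*-cancelʳ-< (10 ^ k) (clusters (state k)) 2 (begin-strict
      clusters (state k) * 10 ^ k     ≤⟨ clusters-≤ k ⟩
      36 * n * 9 ^ k + 10 ^ k         <⟨ +-monoˡ-< (10 ^ k) (power-exceeds (36 * n) j) ⟩
      10 ^ k + 10 ^ k                 ≡⟨ cong (10 ^ k +_) (+-identityʳ (10 ^ k)) ⟨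
      2 * 10 ^ k                      ∎)))
    (run-nonempty 10 9 k (initT T) (subst (1 ≤_)
      (sym (trans (initial-weight (λ _ → 1) 1 (λ _ _ → refl)) (*-identityˡ n))) 1≤n))
    where
    k = j + 9 * (36 * n)

  module _ {s t : ℕ} (1≤s : 1 ≤ s) (2α^t≤s : 2 * 10 ^ t ≤ s * 9 ^ t) where

    -- The size bound α^j grows with `j`, so both participants have size at most α^t.
    ok-merge-≤ : ∀ j → j ≤ t → ∀ (x y : TopTree σ) → Step.ok 10 9 j x y ≡ true → edges x + edges y ≤ s
    ok-merge-≤ j j≤t x y ok-xy = *-cancelʳ-≤ _ s (9 ^ t) {{m^n≢0 9 t}} (begin
      (edges x + edges y) * 9 ^ t        ≡⟨ *-distribʳ-+ (9 ^ t) (edges x) (edges y) ⟩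
      edges x * 9 ^ t + edges y * 9 ^ t  ≤⟨ +-mono-≤ (later (edges x) (proj₁ h)) (later (edges y) (proj₂ h)) ⟩
      10 ^ t + 10 ^ t                    ≡⟨ cong (10 ^ t +_) (+-identityʳ (10 ^ t)) ⟨
      2 * 10 ^ t                         ≤⟨ 2α^t≤s ⟩
      s * 9 ^ t                          ∎)
      where
      h = ok-≤ 10 9 j x y ok-xy
      later : ∀ e → e * 9 ^ j ≤ 10 ^ j → e * 9 ^ t ≤ 10 ^ t
      later e e≤ = begin
        e * 9 ^ t                  ≡⟨ cong (λ i → e * 9 ^ i) (m+[n∸m]≡n j≤t) ⟨
        e * 9 ^ (j + (t ∸ j))      ≡⟨ cong (e *_) (^-distribˡ-+-* 9 j (t ∸ j)) ⟩
        e * (9 ^ j * 9 ^ (t ∸ j))  ≡⟨ *-assoc e (9 ^ j) (9 ^ (t ∸ j)) ⟨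
        e * 9 ^ j * 9 ^ (t ∸ j)    ≤⟨ *-mono-≤ e≤ (^-monoˡ-≤ (t ∸ j) (n≤1+n 9)) ⟩
        10 ^ j * 10 ^ (t ∸ j)      ≡⟨ ^-distribˡ-+-* 10 j (t ∸ j) ⟨
        10 ^ (j + (t ∸ j))         ≡⟨ cong (10 ^_) (m+[n∸m]≡n j≤t) ⟩
        10 ^ t                     ∎

    no-bigs : weight (bigs s) (state t) ≡ 0
    no-bigs = n≤0⇒n≡0 (≤-trans
      (run-≤ 10 9 (bigs s) 0 t
        (λ j j≤t m x y ok-xy → ≤-reflexive (bigs-merge-small s m x y (ok-merge-≤ j j≤t x y ok-xy)))
        (initT T))
      (≤-reflexive (initial-weight (bigs s) 0 (λ a b → bigs-leaf s a b 1≤s))))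

    -- Each merge creates at most one big node and destroys one cluster.
    bigs-≤ : ∀ k tt → state (t + k) ≡ singleCluster tt → bigs s tt ≤ clusters (state t)
    bigs-≤ k tt eq = begin
      bigs s tt                                          ≤⟨ m≤n⇒m≤1+n (m≤m+n (bigs s tt) 0) ⟩
      charge tt                                          ≡⟨ trans (+-identityʳ _) (+-identityʳ _) ⟨
      weight charge (singleCluster tt)                   ≡⟨ cong (weight charge) eq ⟨
      weight charge (state (t + k))                      ≤⟨ run-≤ 10 9 charge t k charge-merge (initT T) ⟩
      weight charge (state t)                            ≡⟨ weight-linear 1 1 (λ _ → 1) (bigs s) (state t) ⟩
      1 * clusters (state t) + 1 * weight (bigs s) (state t)
        ≡⟨ cong (λ w → 1 * clusters (state t) + 1 * w) no-bigs ⟩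
      1 * clusters (state t) + 0                         ≡⟨ trans (+-identityʳ _) (*-identityˡ _) ⟩
      clusters (state t)                                 ∎
      where
      charge : TopTree σ → ℕ
      -- The factors 1 make this an instance of `weight-linear`.
      charge x = 1 * 1 + 1 * bigs s x
      charge-merge : ∀ j → j ≤ t + k → ∀ m x y → Step.ok 10 9 j x y ≡ true →
        charge (merge m x y) ≤ charge x + charge y
      charge-merge _ _ m x y _ = ≤-by 0 (bigs-merge s m x y) (arith _ _ _)
        where
        arith : ∀ b c d → 1 * 1 + 1 * b + (1 + (c + d)) + 0 ≡ 1 * 1 + 1 * c + (1 * 1 + 1 * d) + b
        arith = solve-∀

  bigs*s-≤ : ∀ {s t} → 2 * 10 ^ t ≤ s * 9 ^ t → s * 9 ^ t ≤ 3 * 10 ^ t → 1 ≤ s → s ≤ suc n → ∀ k tt →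
    state (t + k) ≡ singleCluster tt → ∀ c → 109 ≤ c → bigs s tt * s ≤ c * suc n
  bigs*s-≤ {s} {t} lower upper 1≤s s≤n k tt eq c 109≤c = *-cancelʳ-≤ _ _ (10 ^ t) {{m^n≢0 10 t}} (begin
    bigs s tt * s * 10 ^ t                    ≤⟨ *-monoˡ-≤ (10 ^ t) (*-monoˡ-≤ s (bigs-≤ {t = t} 1≤s lower k tt eq)) ⟩
    clusters (state t) * s * 10 ^ t           ≡⟨ shuffle (clusters (state t)) s (10 ^ t) ⟩
    clusters (state t) * 10 ^ t * s           ≤⟨ *-monoˡ-≤ s (clusters-≤ t) ⟩
    (36 * n * 9 ^ t + 10 ^ t) * s             ≡⟨ expand n (9 ^ t) (10 ^ t) s ⟩
    36 * n * (s * 9 ^ t) + s * 10 ^ t         ≤⟨ +-mono-≤ (*-monoʳ-≤ (36 * n) upper) (*-monoˡ-≤ (10 ^ t) s≤n) ⟩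
    -- 109 = 36 · 3 + 1, with the 3 from `threshold` and the 1 from the additive term of
    -- `clusters-≤`.
    36 * n * (3 * 10 ^ t) + suc n * 10 ^ t    ≤⟨ ≤-by {X = 0} {Y = 0} (108 * 10 ^ t) z≤n (collect n (10 ^ t)) ⟩
    109 * suc n * 10 ^ t                      ≤⟨ *-monoˡ-≤ (10 ^ t) (*-monoˡ-≤ (suc n) 109≤c) ⟩
    c * suc n * 10 ^ t                        ∎)
    where
    shuffle : ∀ a b c → a * b * c ≡ a * c * b
    shuffle = solve-∀
    expand : ∀ n a b s → (36 * n * a + b) * s ≡ 36 * n * (s * a) + s * b
    expand = solve-∀
    collect : ∀ n a → 36 * n * (3 * a) + (1 + n) * a + 0 + 108 * a ≡ 109 * (1 + n) * a + 0
    collect = solve-∀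

-- Choice of s and the final estimate

n≤2^n : ∀ n → n ≤ 2 ^ n
n≤2^n zero = z≤n
n≤2^n (suc n) = +-mono-≤ (m^n>0 2 n) (≤-trans (n≤2^n n) (m≤m+n (2 ^ n) 0))

-- The other half y = m - x is at least x, so the factor m is at most 2 y ≤ 2 · 2^y and is absorbed
-- there.
half-power : ∀ x m → 2 * x ≤ m → 2 ^ x * m ≤ 2 * 2 ^ m
half-power x m 2x≤m = begin
  2 ^ x * m                ≡⟨ cong (2 ^ x *_) (m+[n∸m]≡n x≤m) ⟨
  2 ^ x * (x + y)          ≤⟨ *-monoʳ-≤ (2 ^ x) (+-monoˡ-≤ y x≤y) ⟩
  2 ^ x * (y + y)          ≤⟨ *-monoʳ-≤ (2 ^ x) (+-mono-≤ (n≤2^n y) (n≤2^n y)) ⟩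
  2 ^ x * (2 ^ y + 2 ^ y)  ≡⟨ eq (2 ^ x) (2 ^ y) ⟩
  2 * (2 ^ x * 2 ^ y)      ≡⟨ cong (2 *_) (^-distribˡ-+-* 2 x y) ⟨
  2 * 2 ^ (x + y)          ≡⟨ cong (λ i → 2 * 2 ^ i) (m+[n∸m]≡n x≤m) ⟩
  2 * 2 ^ m                ∎
  where
  y = m ∸ x
  x≤m : x ≤ m
  x≤m = ≤-trans (m≤m+n x (x + 0)) 2x≤m
  x≤y : x ≤ y
  x≤y = subst (_≤ m ∸ x) (trans (cong (_∸ x) (cong (x +_) (+-identityʳ x))) (m+n∸m≡n x x)) (∸-monoˡ-≤ x 2x≤m)
  eq : ∀ a b → a * (b + b) ≡ 2 * (a * b)
  eq = solve-∀

symbols-≤ : ∀ σ l → σ ≤ 2 ^ l → 1 ≤ l → σ * σ + 5 ≤ 2 ^ (l * 4)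
symbols-≤ σ l σ≤a 1≤l = begin
  σ * σ + 5             ≤⟨ +-monoˡ-≤ 5 (*-mono-≤ σ≤a σ≤a) ⟩
  a * a + 5             ≤⟨ ≤-by 7 (*-monoʳ-≤ 3 4≤a*a) (eq (a * a)) ⟩
  4 * (a * a)           ≤⟨ *-monoˡ-≤ (a * a) 4≤a*a ⟩
  a * a * (a * a)       ≡⟨ assoc a ⟩
  a ^ 4                 ≡⟨ ^-*-assoc 2 l 4 ⟩
  2 ^ (l * 4)           ∎
  where
  a = 2 ^ l
  2≤a : 2 ≤ a
  2≤a = ^-monoʳ-≤ 2 1≤l
  4≤a*a : 4 ≤ a * a
  4≤a*a = *-mono-≤ 2≤a 2≤a
  eq : ∀ b → b + 5 + 3 * b + 7 ≡ 4 * b + 3 * 4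
  eq = solve-∀
  assoc : ∀ a → a * a * (a * a) ≡ a * (a * (a * (a * 1)))
  assoc = solve-∀

divide : ∀ m d → 1 ≤ d → Σ ℕ λ s → d * s ≤ m × m ≤ d * suc s
divide m (suc d) _ = m / suc d ,
  subst (_≤ m) (*-comm (m / suc d) (suc d)) (m/n*n≤m m (suc d)) ,
  (begin
    m                                   ≡⟨ m≡m%n+[m/n]*n m (suc d) ⟩
    m % suc d + m / suc d * suc d       ≤⟨ +-monoˡ-≤ _ (<⇒≤ (m%n<n m (suc d))) ⟩
    suc d + m / suc d * suc d           ≡⟨ *-comm (suc (m / suc d)) (suc d) ⟩
    suc d * suc (m / suc d)             ∎)

combine-large : ∀ c N m l e d → 2 ≤ c → d ≤ 2 * e → e ≤ N → m ≤ 16 * l * 2 → d * m ≤ (c * 32 + 2) * N * l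
combine-large c N m l e d 2≤c d≤2e e≤N m≤32l = begin
  d * m                  ≤⟨ *-mono-≤ (≤-trans d≤2e (*-mono-≤ 2≤c e≤N)) m≤32l ⟩
  c * N * (16 * l * 2)   ≤⟨ ≤-by {X = 0} {Y = 0} (2 * N * l) z≤n (eq c N l) ⟩
  (c * 32 + 2) * N * l   ∎
  where
  eq : ∀ c N l → c * N * (16 * l * 2) + 0 + 2 * N * l ≡ (c * 32 + 2) * N * l + 0
  eq = solve-∀

-- The 32 comes from m ≤ 16 l (s + 1) ≤ 32 l s; the 2 is the share of the small trees.
combine-small : ∀ c N m l s b P d → 1 ≤ s → d ≤ b + P → m ≤ 16 * l * suc s →
  b * s ≤ c * N → P * m ≤ 2 * N * l → d * m ≤ (c * 32 + 2) * N * l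
combine-small c N m l s b P d 1≤s d≤ m≤ bs≤ Pm≤ = begin
  d * m                                ≤⟨ *-monoˡ-≤ m d≤ ⟩
  (b + P) * m                          ≡⟨ *-distribʳ-+ m b P ⟩
  b * m + P * m                        ≤⟨ +-mono-≤ (*-monoʳ-≤ b (≤-trans m≤ (*-monoʳ-≤ (16 * l) (+-monoˡ-≤ s 1≤s)))) Pm≤ ⟩
  b * (16 * l * (s + s)) + 2 * N * l   ≡⟨ cong (_+ 2 * N * l) (regroup b l s) ⟩
  b * s * (32 * l) + 2 * N * l         ≤⟨ +-monoˡ-≤ (2 * N * l) (*-monoˡ-≤ (32 * l) bs≤) ⟩
  c * N * (32 * l) + 2 * N * l         ≡⟨ collect c N l ⟩
  (c * 32 + 2) * N * l                 ∎
  where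
  regroup : ∀ b l s → b * (16 * l * (s + s)) ≡ b * s * (32 * l)
  regroup = solve-∀
  collect : ∀ c N l → c * N * (32 * l) + 2 * N * l ≡ (c * 32 + 2) * N * l
  collect = solve-∀

small-count : ∀ σ l s m N → σ ≤ 2 ^ l → 1 ≤ l → 16 * l * s ≤ m → 2 ^ m ≤ N →
  (σ * σ + 5) ^ (2 * s) * m ≤ 2 * N * l
small-count σ l s m N σ≤2^l 1≤l 16ls≤m 2^m≤N = begin
  (σ * σ + 5) ^ (2 * s) * m      ≤⟨ *-monoˡ-≤ m (^-monoˡ-≤ (2 * s) (symbols-≤ σ l σ≤2^l 1≤l)) ⟩
  (2 ^ (l * 4)) ^ (2 * s) * m    ≡⟨ cong (_* m) (^-*-assoc 2 (l * 4) (2 * s)) ⟩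
  2 ^ (l * 4 * (2 * s)) * m      ≤⟨ half-power (l * 4 * (2 * s)) m (subst (_≤ m) (regroup l s) 16ls≤m) ⟩
  2 * 2 ^ m                      ≤⟨ *-monoʳ-≤ 2 2^m≤N ⟩
  2 * N                          ≡⟨ *-identityʳ (2 * N) ⟨
  2 * N * 1                      ≤⟨ *-monoʳ-≤ (2 * N) 1≤l ⟩
  2 * N * l                      ∎
  where
  regroup : ∀ l s → 16 * l * s ≡ 2 * (l * 4 * (2 * s))
  regroup = solve-∀

-- The constant is a variable c, since products with a large literal would unfold in unary.
module _ (c : ℕ) (109≤c : 109 ≤ c) {σ : ℕ} (T : Tree (Fin σ)) (n : ℕ) (n-edges : nodeCount T ≡ suc n)
  (1≤n : 1 ≤ n) (m l : ℕ) (1≤l : 1 ≤ l) (σ≤2^l : σ ≤ 2 ^ l) (2^m≤N : 2 ^ m ≤ suc n) where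
  open Bounds T n n-edges

  Compressed : ℕ → Set
  Compressed N = Σ ℕ λ k → Σ (TopTree σ) λ tt →
    (state k ≡ singleCluster tt) × (dagSize tt * m ≤ (c * 32 + 2) * N * l)

  -- Here log n is at most about 32 log σ, so a DAG of linear size meets the bound.
  large-alphabet : m ≤ 16 * l * 2 → Compressed (suc n)
  large-alphabet m≤32l = let tt , done = finished 0 1≤n in
    9 * (36 * n) , tt , done ,
    combine-large c (suc n) m l (edges tt) (dagSize tt) (≤-trans (m≤m+n 2 107) 109≤c)
      (dagSize≤2*edges tt) (≤-trans (edges-tt (9 * (36 * n)) tt done) (n≤1+n n)) m≤32l
    where
    edges-tt : ∀ k tt → state k ≡ singleCluster tt → edges tt ≤ n
    edges-tt k tt done = begin
      edges tt                         ≡⟨ trans (+-identityʳ _) (+-identityʳ _) ⟨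
      weight edges (singleCluster tt)  ≡⟨ cong (weight edges) done ⟨
      weight edges (state k)           ≤⟨ edges-≤ k ⟩
      n                                ∎

  small-alphabet : ∀ s → 2 ≤ s → 16 * l * s ≤ m → m ≤ 16 * l * suc s → Compressed (suc n)
  small-alphabet s 2≤s 16ls≤m m≤ =
    let t , below , above = threshold s 2≤s
        tt , done = finished t 1≤n
    in t + 9 * (36 * n) , tt , done ,
       combine-small c (suc n) m l s (bigs s tt) ((σ * σ + 5) ^ (2 * s)) (dagSize tt) 1≤s
         (dagSize-≤ s tt) m≤ (bigs*s-≤ {s} {t} below above 1≤s s≤N (9 * (36 * n)) tt done c 109≤c)
         (small-count σ l s m (suc n) σ≤2^l 1≤l 16ls≤m 2^m≤N)
    where
    1≤s : 1 ≤ s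
    1≤s = ≤-trans (n≤1+n 1) 2≤s
    s≤N : s ≤ suc n
    s≤N = begin
      s           ≡⟨ *-identityˡ s ⟨
      1 * s       ≤⟨ *-monoˡ-≤ s (*-mono-≤ (m≤m+n 1 15) 1≤l) ⟩
      16 * l * s  ≤⟨ 16ls≤m ⟩
      m           ≤⟨ n≤2^n m ⟩
      2 ^ m       ≤⟨ 2^m≤N ⟩
      suc n       ∎

  compressed : Compressed (nodeCount T)
  -- A symbol takes at most 4 l bits and a small tree has at most 2 s nodes, so there are at most
  -- 2^(8 l s) small trees; 16 l s ≤ m keeps this below the square root of 2^m.
  compressed rewrite n-edges = let s , lower , upper = divide m (16 * l) (*-mono-≤ (m≤m+n 1 15) 1≤l) in
    cases s lower upper
    where
    cases : ∀ s → 16 * l * s ≤ m → m ≤ 16 * l * suc s → Compressed (suc n)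
    cases s lower upper with 2 ≤? s
    ... | yes 2≤s = small-alphabet s 2≤s lower upper
    ... | no 2≰s = large-alphabet (≤-trans upper (*-monoʳ-≤ (16 * l) (≰⇒> 2≰s)))

theorem3 : Σ ℕ λ C → (σ : ℕ) → 2 ≤ σ → (T : Tree (Fin σ)) → 2 ≤ nodeCount T →
    Σ ℕ λ k → Σ (TopTree σ) λ tt →
    (run 10 9 k (initT T) ≡ singleCluster tt)
    × (dagSize tt * ⌊log₂ nodeCount T ⌋ ≤ C * nodeCount T * ⌈log₂ σ ⌉)
theorem3 = 109 * 32 + 2 , λ { σ 2≤σ T@(node _ ts) (s≤s 1≤n) →
  compressed 109 ≤-refl T (nodeCountList ts) refl 1≤n ⌊log₂ nodeCount T ⌋ ⌈log₂ σ ⌉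
    (⌈log₂⌉-mono-≤ 2≤σ) (n≤2^⌈log₂n⌉ σ) (2^⌊log₂n⌋≤n (nodeCount T) (s≤s z≤n)) }
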